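{- Every $1$-saturated subcubic graph $G$ such that $g_3(G)\le 4$ is $(1,2,2,2)$-packing colorable.
   Context: All graphs are finite, simple and undirected. For a non-decreasing sequence $S=(s_1,\dots,s_k)$ of positive integers, an $S$-packing coloring of $G$ is a partition of $V(G)$ into sets $V_1,\dots,V_k$ such that any two distinct vertices $u,v\in V_i$ satisfy $dist_G(u,v)>s_i$; $G$ is $S$-packing colorable if it admits one. $G$ is subcubic if its maximum degree is at most $3$. A subcubic graph is $k$-saturated if every vertex of degree $3$ is adjacent to at most $k$ vertices of degree $3$. The local girth $g(v)$ of a vertex $v$ is the length of a shortest cycle containing $v$ ($\infty$ if none), and $g_3(G)=\max\{g(v): d_G(v)=3\}$. -}

module Defs where

open import Data.Nat using (ℕ; zero; suc; _+_; _≤_; _<_)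
open import Data.Bool using (Bool; true; false; T; if_then_else_)
open import Data.Fin using (Fin; toℕ; inject₁; fromℕ) renaming (zero to fzero; suc to fsuc)
open import Data.List using (List; map; allFin)
open import Data.Nat.ListAction using (sum)
open import Data.Product using (Σ; ∃; _×_; _,_)
open import Function.Definitions using (Injective)
open import Relation.Binary.PropositionalEquality using (_≡_)
open import Relation.Nullary using (¬_)

record Graph : Set where
  field
    n     : ℕ
    adj   : Fin n → Fin n → Bool
    sym   : ∀ u v → adj u v ≡ adj v u
    irrefl : ∀ v → adj v v ≡ false
open Graph public

Adj : (G : Graph) → Fin (n G) → Fin (n G) → Set
Adj G u v = T (adj G u v)

degree : (G : Graph) → Fin (n G) → ℕ
degree G v = sum (map (λ u → if adj G v u then 1 else 0) (allFin (n G)))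

Subcubic : Graph → Set
Subcubic G = ∀ v → degree G v ≤ 3

degree3Nbrs : (G : Graph) → Fin (n G) → ℕ
degree3Nbrs G v = sum (map (λ u → if adj G v u then (if isThree (degree G u) then 1 else 0) else 0) (allFin (n G)))
  where
  isThree : ℕ → Bool
  isThree 3 = true
  isThree _ = false

Saturated : ℕ → Graph → Set
Saturated k G = ∀ v → degree G v ≡ 3 → degree3Nbrs G v ≤ k

data Walk (G : Graph) : Fin (n G) → Fin (n G) → ℕ → Set where
  here : ∀ {v} → Walk G v v 0
  step : ∀ {u w v} {k} → Adj G u w → Walk G w v k → Walk G u v (suc k)

-- dist_G(u,v) > s  (distance ∞ if no walk)
DistGreater : (G : Graph) → Fin (n G) → Fin (n G) → ℕ → Set
DistGreater G u v s = ∀ k → k ≤ s → ¬ Walk G u v k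

record Cycle (G : Graph) (m : ℕ) : Set where
  field
    vtx    : Fin (3 + m) → Fin (n G)
    inj    : Injective _≡_ _≡_ vtx
    consec : ∀ (i : Fin (2 + m)) → Adj G (vtx (inject₁ i)) (vtx (fsuc i))
    close  : Adj G (vtx (fromℕ (2 + m))) (vtx fzero)
open Cycle public

OnCycle : (G : Graph) → Fin (n G) → (m : ℕ) → Set
OnCycle G v m = Σ (Cycle G m) λ C → ∃ λ i → vtx C i ≡ v

LocalGirthAtMost : (G : Graph) → Fin (n G) → ℕ → Set
LocalGirthAtMost G v L = ∃ λ m → 3 + m ≤ L × OnCycle G v m

G3AtMost : Graph → ℕ → Set
G3AtMost G L = ∀ v → degree G v ≡ 3 → LocalGirthAtMost G v L

PackingColoring : (G : Graph) (k : ℕ) (S : Fin k → ℕ) → (Fin (n G) → Fin k) → Set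
PackingColoring G k S c = ∀ u v → ¬ (u ≡ v) → c u ≡ c v → DistGreater G u v (S (c u))

PackingColorable : (G : Graph) (k : ℕ) (S : Fin k → ℕ) → Set
PackingColorable G k S = ∃ λ (c : Fin (n G) → Fin k) → PackingColoring G k S c

S1222 : Fin 4 → ℕ
S1222 fzero = 1
S1222 (fsuc _) = 2

-- Choose an independent set I for the colour of distance 1 and colour the rest greedily with three
-- colours: in the square of G restricted to V ∖ I, deleting first the vertices of degree at most 2
-- that share a short cycle with a degree-3 vertex, and then all others, every vertex has at most two
-- remaining neighbours when it is deleted.
-- For this, I must be maximal and contain
--  * both degree-2 vertices of a 4-cycle that are opposite each other and share a degree-3
--    neighbour (twins);
--  * for each triangle with two degree-3 vertices v and a, the outer neighbour of at least one of
--    them.  The choice is made by a 2-colouring f of the union of two matchings on the degree-3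
--    vertices: va for v adjacent to a, and vv′ for adjacent outer neighbours of v and v′, so that the
--    chosen outer neighbours are independent.
-- Subject to this, I prefers degree-3 vertices to the others.
module Submission where

open import Defs
open import Data.Bool using (Bool; true; false; T; not; if_then_else_)
open import Data.Bool.Properties using (T?; T-≡; not-¬; ¬-not; not-involutive) renaming (_≟_ to _≟ᵇ_)
open import Data.Empty using (⊥)
open import Data.Fin using (Fin; zero; suc) renaming (_<_ to _<ᶠ_)
open import Data.Fin.Properties using (_≟_; any?; all?; pigeonhole; suc-injective)
  renaming (_<?_ to _<ᶠ?_; <-cmp to <ᶠ-cmp)
open import Data.List using (List; []; _∷_; map; length; filter; lookup; allFin)
open import Data.List.Membership.Propositional using (_∈_)
open import Data.List.Membership.Propositional.Properties using (∈-filter⁺; ∈-filter⁻; ∈-allFin; ∈-lookup)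
open import Data.List.Relation.Unary.All as All using (All; []; _∷_)
open import Data.List.Relation.Unary.AllPairs using ([]; _∷_)
open import Data.List.Relation.Unary.Any using (here; there; index)
open import Data.List.Relation.Unary.Any.Properties using (lookup-index)
open import Data.List.Relation.Unary.Unique.Propositional using (Unique)
open import Data.List.Relation.Unary.Unique.Propositional.Properties using (allFin⁺; filter⁺)
open import Data.Nat using (ℕ; suc; _+_; _≤_; _<_; s≤s; _<?_)
open import Data.Nat.ListAction using (sum)
import Data.Nat.Properties as ℕ
open import Data.Product using (∃; ∃₂; _×_; _,_; proj₁; proj₂)
open import Data.Sum using (_⊎_; inj₁; inj₂; map₂; swap; [_,_])
open import Function using (_∘_)
open import Function.Bundles using (Equivalence)
open import Relation.Binary using (Decidable; tri<; tri≈; tri>)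
open import Relation.Binary.PropositionalEquality using (_≡_; _≢_; refl; trans; cong; subst; ≢-sym) renaming (sym to ≡-sym)
open import Relation.Nullary using (¬_; Dec; does; yes; no; contradiction)
open import Relation.Nullary.Decidable using (_×-dec_; _⊎-dec_; ¬?; toWitness; decidable-stable)
import Relation.Unary as Unary

-- Sums and lengths of finite lists.

module _ {A : Set} where

  -- Turns the sum that defines `degree` into the length of a list of neighbours.
  count≡length : (b : A → Bool) (xs : List A) →
    sum (map (λ x → if b x then 1 else 0) xs) ≡ length (filter (T? ∘ b) xs)
  count≡length b [] = refl
  count≡length b (x ∷ xs) with b x
  ... | true  = cong (1 +_) (count≡length b xs)
  ... | false = count≡length b xs

  ∈⇒≤sum : (g : A → ℕ) {x : A} {xs : List A} → x ∈ xs → g x ≤ sum (map g xs)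
  ∈⇒≤sum g {xs = y ∷ ys} (here refl) = ℕ.m≤m+n (g y) _
  ∈⇒≤sum g {xs = y ∷ ys} (there x∈) = ℕ.≤-trans (∈⇒≤sum g x∈) (ℕ.m≤n+m _ (g y))

  -- Serves to show that two degree-3 neighbours of a vertex add 2 to `degree3Nbrs`.
  ∈∈⇒+≤sum : (g : A → ℕ) {x y : A} {xs : List A} → x ∈ xs → y ∈ xs → x ≢ y →
    g x + g y ≤ sum (map g xs)
  ∈∈⇒+≤sum g (here refl) (here refl) x≢y = contradiction refl x≢y
  ∈∈⇒+≤sum g {x} (here refl) (there y∈) _ = ℕ.+-monoʳ-≤ (g x) (∈⇒≤sum g y∈)
  ∈∈⇒+≤sum g {x} {y} (there x∈) (here refl) _ =
    ℕ.≤-trans (ℕ.≤-reflexive (ℕ.+-comm (g x) (g y))) (ℕ.+-monoʳ-≤ (g y) (∈⇒≤sum g x∈))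
  ∈∈⇒+≤sum g {xs = z ∷ zs} (there x∈) (there y∈) x≢y =
    ℕ.≤-trans (∈∈⇒+≤sum g x∈ y∈ x≢y) (ℕ.m≤n+m _ (g z))

  unique-lookup : {xs : List A} → Unique xs → ∀ i j → i <ᶠ j → lookup xs i ≢ lookup xs j
  unique-lookup (x∉ ∷ _) zero (suc j) _ = All.lookup x∉ (∈-lookup j)
  unique-lookup (_ ∷ uniq) (suc i) (suc j) (s≤s i<j) = unique-lookup uniq i j i<j

  -- Pigeonhole: if `ys` were shorter, two positions of `xs` would be sent to one position of `ys`,
  -- so `xs` would repeat an entry.
  unique-⊆⇒length≤ : {xs ys : List A} → Unique xs → All (_∈ ys) xs → length xs ≤ length ys
  unique-⊆⇒length≤ {xs} {ys} uniq xs⊆ys with length ys <? length xs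
  ... | no ys≮xs = ℕ.≮⇒≥ ys≮xs
  ... | yes ys<xs = contradiction same (unique-lookup uniq i j i<j)
    where
    position : ∀ i → lookup xs i ∈ ys
    position i = All.lookup xs⊆ys (∈-lookup i)
    collision = pigeonhole ys<xs (index ∘ position)
    i = proj₁ collision
    j = proj₁ (proj₂ collision)
    i<j = proj₁ (proj₂ (proj₂ collision))
    same : lookup xs i ≡ lookup xs j
    same = trans (lookup-index (position i))
      (trans (cong (lookup ys) (proj₂ (proj₂ (proj₂ collision)))) (≡-sym (lookup-index (position j))))

-- `p` is a mere candidate and need not satisfy `P`; if nothing does, any choice of `p` works.
AtMostOne : {V : Set} → (V → Set) → Set
AtMostOne P = ∃ λ p → ∀ {w} → P w → w ≡ p

AtMostTwo : {V : Set} → (V → Set) → Set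
AtMostTwo P = ∃₂ λ p q → ∀ {w} → P w → w ≡ p ⊎ w ≡ q

thirdColour : (a b : Fin 3) → ∃ λ c → c ≢ a × c ≢ b
thirdColour = toWitness {a? = all? λ a → all? λ b → any? λ c → ¬? (c ≟ a) ×-dec ¬? (c ≟ b)} _

-- Two-colouring the union of two matchings.

module _ {n : ℕ} where

  private V = Fin n

  record IsMatching (R : V → V → Set) : Set where
    field
      dec         : Decidable R
      symmetric   : ∀ {u v} → R u v → R v u
      irreflexive : ∀ {u} → ¬ R u u
      functional  : ∀ {u v w} → R u v → R u w → v ≡ w
  open IsMatching

  Separates : (V → Bool) → (V → V → Set) → Set
  Separates f R = ∀ {u v} → R u v → f u ≢ f v

  -- A vertex gets `true` exactly when it is the smaller end of its edge.
  matching-2-colourable : {S : V → V → Set} → IsMatching S → ∃ λ f → Separates f S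
  matching-2-colourable {S} mS = f , sep
    where
    smaller? : ∀ u → Dec (∃ λ v → S u v × u <ᶠ v)
    smaller? u = any? λ v → dec mS u v ×-dec (u <ᶠ? v)
    f : V → Bool
    f u = does (smaller? u)
    sep : Separates f S
    sep {u} {v} Suv with smaller? u | smaller? v
    ... | yes _ | no _ = λ ()
    ... | no _ | yes _ = λ ()
    ... | yes (x , Sux , u<x) | yes (y , Svy , v<y)
      with refl ← functional mS Sux Suv | refl ← functional mS Svy (symmetric mS Suv) =
      contradiction v<y (ℕ.<⇒≯ u<x)
    ... | no u≮ | no v≮ with <ᶠ-cmp u v
    ...   | tri< u<v _ _ = contradiction (v , Suv , u<v) u≮
    ...   | tri≈ _ refl _ = contradiction Suv (irreflexive mS)
    ...   | tri> _ _ v<u = contradiction (u , symmetric mS Suv , v<u) v≮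

  -- Contracting the R-edge xy: the S-partners of x and y become S-partners of each other.
  module Contract {R S : V → V → Set} (mR : IsMatching R) (mS : IsMatching S) {x y : V} (Rxy : R x y) where

    Kept : V → Set
    Kept u = u ≢ x × u ≢ y

    kept? : Unary.Decidable Kept
    kept? u = ¬? (u ≟ x) ×-dec ¬? (u ≟ y)

    R′ : V → V → Set
    R′ u v = R u v × Kept u × Kept v

    S′ : V → V → Set
    S′ u v = (S u v ⊎ S u x × S v y ⊎ S u y × S v x) × Kept u × Kept v

    x≢y : x ≢ y
    x≢y refl = irreflexive mR Rxy

    mR′ : IsMatching R′
    mR′ .dec u v = dec mR u v ×-dec kept? u ×-dec kept? v
    mR′ .symmetric (Ruv , ku , kv) = symmetric mR Ruv , kv , ku
    mR′ .irreflexive = irreflexive mR ∘ proj₁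
    mR′ .functional p q = functional mR (proj₁ p) (proj₁ q)

    S-injective : ∀ {u v w} → S u w → S v w → u ≡ v
    S-injective p q = functional mS (symmetric mS p) (symmetric mS q)

    -- A kept vertex with a kept `S`-partner retains it; one matched to `x` or `y` can only be
    -- joined to the `S`-partner of the other end. A loop would need a vertex matched to both `x`
    -- and `y`.
    mS′ : IsMatching S′
    mS′ .dec u v = (dec mS u v ⊎-dec dec mS u x ×-dec dec mS v y ⊎-dec dec mS u y ×-dec dec mS v x)
      ×-dec kept? u ×-dec kept? v
    mS′ .symmetric (inj₁ p , ku , kv) = inj₁ (symmetric mS p) , kv , ku
    mS′ .symmetric (inj₂ (inj₁ (p , q)) , ku , kv) = inj₂ (inj₂ (q , p)) , kv , ku
    mS′ .symmetric (inj₂ (inj₂ (p , q)) , ku , kv) = inj₂ (inj₁ (q , p)) , kv , ku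
    mS′ .irreflexive (inj₁ p , _) = irreflexive mS p
    mS′ .irreflexive (inj₂ (inj₁ (p , q)) , _) = x≢y (functional mS p q)
    mS′ .irreflexive (inj₂ (inj₂ (p , q)) , _) = x≢y (functional mS q p)
    mS′ .functional (inj₁ p , _ , kv) (inj₁ q , _) = functional mS p q
    mS′ .functional (inj₁ p , _ , kv) (inj₂ (inj₁ (q , _)) , _) = contradiction (functional mS p q) (proj₁ kv)
    mS′ .functional (inj₁ p , _ , kv) (inj₂ (inj₂ (q , _)) , _) = contradiction (functional mS p q) (proj₂ kv)
    mS′ .functional (inj₂ (inj₁ (p , _)) , _) (inj₁ q , _ , kv) = contradiction (functional mS q p) (proj₁ kv)
    mS′ .functional (inj₂ (inj₂ (p , _)) , _) (inj₁ q , _ , kv) = contradiction (functional mS q p) (proj₂ kv)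
    mS′ .functional (inj₂ (inj₁ (_ , p)) , _) (inj₂ (inj₁ (_ , q)) , _) = S-injective p q
    mS′ .functional (inj₂ (inj₂ (_ , p)) , _) (inj₂ (inj₂ (_ , q)) , _) = S-injective p q
    mS′ .functional (inj₂ (inj₁ (p , _)) , _) (inj₂ (inj₂ (q , _)) , _) = contradiction (functional mS p q) x≢y
    mS′ .functional (inj₂ (inj₂ (p , _)) , _) (inj₂ (inj₁ (q , _)) , _) = contradiction (functional mS q p) x≢y

    module _ {f′ : V → Bool} (sepR : Separates f′ R′) (sepS : Separates f′ S′) where

      -- `β` is meant for `x` and `not β` for `y`. If both have kept `S`-partners, these are joined
      -- by `S′` and differ in colour, so the two demands on `β` agree.
      endColour : ∃ λ β → (∀ {p} → S x p → Kept p → f′ p ≢ β) × (∀ {q} → S y q → Kept q → f′ q ≢ not β)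
      endColour with any? (λ p → dec mS x p ×-dec kept? p)
      ... | yes (p , Sxp , kp) = not (f′ p) ,
          (λ Sxr _ → not-¬ (cong f′ (functional mS Sxr Sxp))) ,
          λ {q} Syq kq eq → sepS {p} {q} (inj₂ (inj₁ (symmetric mS Sxp , symmetric mS Syq)) , kp , kq)
            (trans (≡-sym (not-involutive (f′ p))) (≡-sym eq))
      ... | no lone-x with any? (λ q → dec mS y q ×-dec kept? q)
      ...   | yes (q , Syq , kq) = f′ q ,
          (λ {p} Sxp kp → contradiction (p , Sxp , kp) lone-x) ,
          λ Syr _ → not-¬ (cong f′ (functional mS Syr Syq))
      ...   | no lone-y = true ,
          (λ {p} Sxp kp → contradiction (p , Sxp , kp) lone-x) ,
          λ {q} Syq kq → contradiction (q , Syq , kq) lone-y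

      β : Bool
      β = proj₁ endColour

      f : V → Bool
      f u with u ≟ x | u ≟ y
      ... | yes _ | _     = β
      ... | no _  | yes _ = not β
      ... | no _  | no _  = f′ u

      separates-ends : ∀ {Q : V → V → Set} → IsMatching Q →
        (∀ {p} → Q x p → Kept p → f′ p ≢ β) → (∀ {q} → Q y q → Kept q → f′ q ≢ not β) →
        (∀ {u v} → Q u v → Kept u → Kept v → f′ u ≢ f′ v) → Separates f Q
      separates-ends mQ atx aty kept {u} {v} Quv with u ≟ x | u ≟ y | v ≟ x | v ≟ y
      ... | yes refl | _ | yes refl | _ = contradiction Quv (irreflexive mQ)
      ... | yes refl | _ | no _ | yes refl = not-¬ refl
      ... | yes refl | _ | no v≢x | no v≢y = ≢-sym (atx Quv (v≢x , v≢y))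
      ... | no _ | yes refl | yes refl | _ = ≢-sym (not-¬ refl)
      ... | no _ | yes refl | no _ | yes refl = contradiction Quv (irreflexive mQ)
      ... | no _ | yes refl | no v≢x | no v≢y = ≢-sym (aty Quv (v≢x , v≢y))
      ... | no u≢x | no u≢y | yes refl | _ = atx (symmetric mQ Quv) (u≢x , u≢y)
      ... | no u≢x | no u≢y | no _ | yes refl = aty (symmetric mQ Quv) (u≢x , u≢y)
      ... | no u≢x | no u≢y | no v≢x | no v≢y = kept Quv (u≢x , u≢y) (v≢x , v≢y)

      f-separates-R : Separates f R
      f-separates-R = separates-ends mR
        (λ Rxp kp → contradiction (functional mR Rxp Rxy) (proj₂ kp))
        (λ Ryq kq → contradiction (functional mR Ryq (symmetric mR Rxy)) (proj₁ kq))
        (λ Ruv ku kv → sepR (Ruv , ku , kv))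

      f-separates-S : Separates f S
      f-separates-S = separates-ends mS (proj₁ (proj₂ endColour)) (proj₂ (proj₂ endColour))
        (λ Suv ku kv → sepS (inj₁ Suv , ku , kv))

  -- Induction on a list that contains all ends of `R`-edges. If the head lies on such an edge,
  -- contracting it leaves the head on no `R`-edge; at the empty list only `S` remains.
  two-matchings-within : (xs : List V) {R S : V → V → Set} → IsMatching R → IsMatching S →
    (∀ {u v} → R u v → u ∈ xs) → ∃ λ f → Separates f R × Separates f S
  two-matchings-within [] mR mS R⊆xs =
    let f , sep = matching-2-colourable mS
    in f , (λ Ruv → contradiction (R⊆xs Ruv) λ ()) , sep
  two-matchings-within (x ∷ xs) {R} mR mS R⊆xs with any? (dec mR x)
  ... | no lone = two-matchings-within xs mR mS R⊆xs′
    where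
    R⊆xs′ : ∀ {u v} → R u v → u ∈ xs
    R⊆xs′ Ruv with R⊆xs Ruv
    ... | here refl = contradiction (_ , Ruv) lone
    ... | there u∈  = u∈
  ... | yes (y , Rxy) = C.f sepR sepS , C.f-separates-R sepR sepS , C.f-separates-S sepR sepS
    where
    module C = Contract mR mS Rxy
    R′⊆xs : ∀ {u v} → C.R′ u v → u ∈ xs
    R′⊆xs (Ruv , ku , _) with R⊆xs Ruv
    ... | here refl = contradiction refl (proj₁ ku)
    ... | there u∈  = u∈
    smaller = two-matchings-within xs C.mR′ C.mS′ R′⊆xs
    sepR = proj₁ (proj₂ smaller)
    sepS = proj₂ (proj₂ smaller)

  -- The union of two matchings has only even cycles.
  two-matchings-2-colourable : {R S : V → V → Set} → IsMatching R → IsMatching S →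
    ∃ λ f → Separates f R × Separates f S
  two-matchings-2-colourable mR mS = two-matchings-within (allFin n) mR mS (λ _ → ∈-allFin _)

  -- Greedy colouring with three colours.

  module _ {H : V → V → Set} (H-sym : ∀ {u v} → H u v → H v u) where

    ProperOn : (V → Set) → (V → Fin 3) → Set
    ProperOn P c = ∀ {u v} → P u → P v → u ≢ v → H u v → c u ≢ c v

    -- The list is coloured from its end to its head. Each entry has at most two relevant
    -- neighbours, so one of the three colours is free.
    extendColouring : {P : V → Set} {c : V → Fin 3} → ProperOn P c → (xs : List V) →
      (∀ {x} → x ∈ xs → AtMostTwo λ w → w ≢ x × H x w × (P w ⊎ w ∈ xs)) →
      ∃ (ProperOn λ w → P w ⊎ w ∈ xs)
    extendColouring {c = c} proper [] _ = c , λ where (inj₁ Pu) (inj₁ Pv) → proper Pu Pv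
    extendColouring {P} proper (x ∷ xs) few = c′ , proper′
      where
      rest = extendColouring proper xs λ x∈ →
        let p , q , only = few (there x∈)
        in p , q , λ (w≢ , h , w∈) → only (w≢ , h , map₂ there w∈)
      c = proj₁ rest
      p = proj₁ (few (here refl))
      q = proj₁ (proj₂ (few (here refl)))
      fresh = thirdColour (c p) (c q)
      -- If `x` already has a colour, overwriting it is safe, since `fresh` avoids the colours of
      -- all its neighbours in `P` and the list.
      c′ : V → Fin 3
      c′ u with u ≟ x
      ... | yes _ = proj₁ fresh
      ... | no _  = c u
      fresh≢ : ∀ {w} → P w ⊎ w ∈ x ∷ xs → w ≢ x → H x w → proj₁ fresh ≢ c w
      fresh≢ w∈ w≢x h with proj₂ (proj₂ (few (here refl))) (w≢x , h , w∈)
      ... | inj₁ refl = proj₁ (proj₂ fresh)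
      ... | inj₂ refl = proj₂ (proj₂ fresh)
      drop-head : ∀ {w} → P w ⊎ w ∈ x ∷ xs → w ≢ x → P w ⊎ w ∈ xs
      drop-head (inj₁ Pw) _ = inj₁ Pw
      drop-head (inj₂ (here w≡x)) w≢x = contradiction w≡x w≢x
      drop-head (inj₂ (there w∈)) _ = inj₂ w∈
      proper′ : ProperOn (λ w → P w ⊎ w ∈ x ∷ xs) c′
      proper′ {u} {v} u∈ v∈ u≢v h with u ≟ x | v ≟ x
      ... | yes refl | yes refl = contradiction refl u≢v
      ... | yes refl | no v≢x = fresh≢ v∈ v≢x h
      ... | no u≢x | yes refl = ≢-sym (fresh≢ u∈ u≢x (H-sym h))
      ... | no u≢x | no v≢x = proj₂ rest (drop-head u∈ u≢x) (drop-head v∈ v≢x) u≢v h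

-- Degrees, neighbourhoods and short cycles.

module LocalStructure (G : Graph) (subcubic : Subcubic G) (saturated : Saturated 1 G)
  (g₃≤4 : G3AtMost G 4) where

  V : Set
  V = Fin (n G)

  infix 4 _~_ _~?_

  _~_ : V → V → Set
  _~_ = Adj G

  _~?_ : Decidable _~_
  u ~? v = T? (adj G u v)

  ~-sym : ∀ {u v} → u ~ v → v ~ u
  ~-sym {u} {v} = subst T (sym G u v)

  ~-irrefl : ∀ {v} → ¬ v ~ v
  ~-irrefl {v} = subst T (irrefl G v)

  ~⇒≢ : ∀ {u v} → u ~ v → u ≢ v
  ~⇒≢ u~u refl = ~-irrefl u~u

  D3 : V → Set
  D3 v = degree G v ≡ 3

  D3? : Unary.Decidable D3
  D3? v = degree G v ℕ.≟ 3

  D3-≢ : ∀ {u v} → D3 u → ¬ D3 v → u ≢ v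
  D3-≢ du ¬dv refl = ¬dv du

  neighbours : V → List V
  neighbours v = filter (v ~?_) (allFin _)

  ∈-neighbours : ∀ {v w} → v ~ w → w ∈ neighbours v
  ∈-neighbours {v} v~w = ∈-filter⁺ (v ~?_) (∈-allFin _) v~w

  neighbours-~ : ∀ {v w} → w ∈ neighbours v → v ~ w
  neighbours-~ {v} w∈ = proj₂ (∈-filter⁻ (v ~?_) {xs = allFin _} w∈)

  neighbours-unique : ∀ v → Unique (neighbours v)
  neighbours-unique v = filter⁺ (v ~?_) (allFin⁺ _)

  degree≡length : ∀ v → degree G v ≡ length (neighbours v)
  degree≡length v = count≡length (adj G v) (allFin _)

  unique-neighbours≤degree : ∀ {v xs} → Unique xs → All (v ~_) xs → length xs ≤ degree G v
  unique-neighbours≤degree {v} uniq v~xs = ℕ.≤-trans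
    (unique-⊆⇒length≤ uniq (All.map ∈-neighbours v~xs)) (ℕ.≤-reflexive (≡-sym (degree≡length v)))

  record Star (v a b c : V) : Set where
    constructor star
    field
      ~a : v ~ a
      ~b : v ~ b
      ~c : v ~ c
      a≢b : a ≢ b
      a≢c : a ≢ c
      b≢c : b ≢ c

  swap-star : ∀ {v a b c} → Star v a b c → Star v b a c
  swap-star (star ~a ~b ~c a≢b a≢c b≢c) = star ~b ~a ~c (≢-sym a≢b) b≢c a≢c

  star-covers : ∀ {v a b c z} → Star v a b c → v ~ z → z ≡ a ⊎ z ≡ b ⊎ z ≡ c
  star-covers {v} {a} {b} {c} {z} (star ~a ~b ~c a≢b a≢c b≢c) ~z with z ≟ a | z ≟ b | z ≟ c
  ... | yes z≡a | _ | _ = inj₁ z≡a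
  ... | no _ | yes z≡b | _ = inj₂ (inj₁ z≡b)
  ... | no _ | no _ | yes z≡c = inj₂ (inj₂ z≡c)
  ... | no z≢a | no z≢b | no z≢c = contradiction
    (ℕ.≤-trans
      (unique-neighbours≤degree
        ((z≢a ∷ z≢b ∷ z≢c ∷ []) ∷ (a≢b ∷ a≢c ∷ []) ∷ (b≢c ∷ []) ∷ [] ∷ [])
        (~z ∷ ~a ∷ ~b ∷ ~c ∷ []))
      (subcubic v))
    (ℕ.<-irrefl refl)

  pair-covers : ∀ {v a b z} → ¬ D3 v → v ~ a → v ~ b → a ≢ b → v ~ z → z ≡ a ⊎ z ≡ b
  pair-covers {v} {a} {b} {z} ¬dv ~a ~b a≢b ~z with z ≟ a | z ≟ b
  ... | yes z≡a | _ = inj₁ z≡a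
  ... | no _ | yes z≡b = inj₂ z≡b
  ... | no z≢a | no z≢b = contradiction
    (ℕ.≤-antisym (subcubic v)
      (unique-neighbours≤degree ((z≢a ∷ z≢b ∷ []) ∷ (a≢b ∷ []) ∷ [] ∷ []) (~z ∷ ~a ∷ ~b ∷ [])))
    ¬dv

  -- With fewer than two neighbours a candidate is repeated, and for an isolated `v` it is `v`
  -- itself, so the candidates need not be neighbours.
  ¬D3⇒few-neighbours : ∀ {v} → ¬ D3 v → AtMostTwo (v ~_)
  ¬D3⇒few-neighbours {v} ¬dv
    with neighbours v | ∈-neighbours {v} | ℕ.≤∧≢⇒< (subcubic v) ¬dv | degree≡length v
  ... | [] | ∈nbrs | _ | _ = v , v , λ v~w → contradiction (∈nbrs v~w) λ ()
  ... | a ∷ [] | ∈nbrs | _ | _ = a , a , λ v~w → case₁ (∈nbrs v~w)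
    where
    case₁ : ∀ {w} → w ∈ a ∷ [] → w ≡ a ⊎ w ≡ a
    case₁ (here w≡a) = inj₁ w≡a
  ... | a ∷ b ∷ [] | ∈nbrs | _ | _ = a , b , λ v~w → case₂ (∈nbrs v~w)
    where
    case₂ : ∀ {w} → w ∈ a ∷ b ∷ [] → w ≡ a ⊎ w ≡ b
    case₂ (here w≡a) = inj₁ w≡a
    case₂ (there (here w≡b)) = inj₂ w≡b
  ... | _ ∷ _ ∷ _ ∷ _ | _ | deg<3 | deg≡ =
    contradiction (subst (_< 3) deg≡ deg<3) λ { (s≤s (s≤s (s≤s ()))) }

  -- Without a third neighbour, three distinct neighbours would fit into a list of length two.
  complete-star : ∀ {v a b} → D3 v → v ~ a → v ~ b → a ≢ b → ∃ (Star v a b)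
  complete-star {v} {a} {b} dv ~a ~b a≢b
    with any? (λ c → (v ~? c) ×-dec ¬? (a ≟ c) ×-dec ¬? (b ≟ c))
  ... | yes (c , ~c , a≢c , b≢c) = c , star ~a ~b ~c a≢b a≢c b≢c
  ... | no no-third = contradiction
    (subst (_≤ 2) (trans (≡-sym (degree≡length v)) dv)
      (unique-⊆⇒length≤ {ys = a ∷ b ∷ []} (neighbours-unique v) (All.tabulate (only ∘ neighbours-~))))
    λ { (s≤s (s≤s ())) }
    where
    only : ∀ {w} → v ~ w → w ∈ a ∷ b ∷ []
    only {w} ~w with a ≟ w | b ≟ w
    ... | yes a≡w | _ = here (≡-sym a≡w)
    ... | no _ | yes b≡w = there (here (≡-sym b≡w))
    ... | no a≢w | no b≢w = contradiction (w , ~w , a≢w , b≢w) no-third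

  -- The form in which 1-saturation is applied: distinct `a` and `b` would make `degree3Nbrs` at `v`
  -- at least 2.
  D3-neighbour-unique : ∀ {v a b} → D3 v → v ~ a → v ~ b → D3 a → D3 b → a ≡ b
  D3-neighbour-unique {v} {a} {b} dv ~a ~b da db with a ≟ b
  ... | yes a≡b = a≡b
  ... | no a≢b with ℕ.≤-trans (∈∈⇒+≤sum _ (∈-allFin a) (∈-allFin b) a≢b) (saturated v dv)
  ...   | two≤1 rewrite Equivalence.to T-≡ ~a | Equivalence.to T-≡ ~b | da | db =
    contradiction two≤1 λ { (s≤s ()) }

  -- For distinct neighbours a and b of v: the path a v b lies on a cycle of length 3 or 4.
  Closed : V → V → V → Set
  Closed v a b = a ~ b ⊎ ∃ λ s → s ≢ v × a ~ s × b ~ s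

  closed? : ∀ v a b → Dec (Closed v a b)
  closed? v a b = (a ~? b) ⊎-dec any? (λ s → ¬? (s ≟ v) ×-dec (a ~? s) ×-dec (b ~? s))

  swap-closed : ∀ {v a b} → Closed v a b → Closed v b a
  swap-closed (inj₁ a~b) = inj₁ (~-sym a~b)
  swap-closed (inj₂ (s , s≢v , a~s , b~s)) = inj₂ (s , s≢v , b~s , a~s)

  -- `a` and `b` are the neighbours of `v` along the cycle of length at most 4 that the bound on the
  -- local girth provides; `c` is the remaining neighbour.
  short-cycle : ∀ {v} → D3 v → ∃₂ λ a b → ∃ λ c → Star v a b c × Closed v a b
  short-cycle {v} dv = corner→star (corner (g₃≤4 v dv))
    where
    corner→star : (∃₂ λ a b → v ~ a × v ~ b × a ≢ b × Closed v a b) →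
      ∃₂ λ a b → ∃ λ c → Star v a b c × Closed v a b
    corner→star (a , b , ~a , ~b , a≢b , closed) =
      let c , st = complete-star dv ~a ~b a≢b in a , b , c , st , closed
    corner : LocalGirthAtMost G v 4 → ∃₂ λ a b → v ~ a × v ~ b × a ≢ b × Closed v a b
    -- The index of a cycle is its length minus 3: index 0 is a triangle, index 1 a 4-cycle.
    corner (0 , _ , C , i , refl) = at i
      where
      x = vtx C
      e₀ = consec C zero
      e₁ = consec C (suc zero)
      e₂ = close C
      at : ∀ i → ∃₂ λ a b → x i ~ a × x i ~ b × a ≢ b × Closed (x i) a b
      at zero = _ , _ , e₀ , ~-sym e₂ , ~⇒≢ e₁ , inj₁ e₁
      at (suc zero) = _ , _ , e₁ , ~-sym e₀ , ~⇒≢ e₂ , inj₁ e₂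
      at (suc (suc zero)) = _ , _ , e₂ , ~-sym e₁ , ~⇒≢ e₀ , inj₁ e₀
    corner (1 , _ , C , i , refl) = at i
      where
      x = vtx C
      e₀ = consec C zero
      e₁ = consec C (suc zero)
      e₂ = consec C (suc (suc zero))
      e₃ = close C
      x₀≢x₂ : x zero ≢ x (suc (suc zero))
      x₀≢x₂ eq = contradiction (inj C eq) λ ()
      x₁≢x₃ : x (suc zero) ≢ x (suc (suc (suc zero)))
      x₁≢x₃ eq = contradiction (inj C eq) λ ()
      at : ∀ i → ∃₂ λ a b → x i ~ a × x i ~ b × a ≢ b × Closed (x i) a b
      at zero = _ , _ , e₀ , ~-sym e₃ , x₁≢x₃ , inj₂ (_ , ≢-sym x₀≢x₂ , e₁ , ~-sym e₂)
      at (suc zero) = _ , _ , e₁ , ~-sym e₀ , ≢-sym x₀≢x₂ , inj₂ (_ , ≢-sym x₁≢x₃ , e₂ , ~-sym e₃)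
      at (suc (suc zero)) = _ , _ , e₂ , ~-sym e₁ , ≢-sym x₁≢x₃ , inj₂ (_ , x₀≢x₂ , e₃ , ~-sym e₀)
      at (suc (suc (suc zero))) = _ , _ , e₃ , ~-sym e₂ , x₀≢x₂ , inj₂ (_ , x₁≢x₃ , e₀ , ~-sym e₁)
    corner (suc (suc _) , s≤s (s≤s (s≤s (s≤s ()))) , _)

  -- Two matchings on the degree-3 vertices.

  -- v is a degree-3 vertex of a triangle v a b whose vertex a also has degree 3, and x is the
  -- neighbour of v outside that triangle.
  Attached : V → V → Set
  Attached v x = D3 v × ¬ D3 x × v ~ x ×
    ∃₂ λ a b → D3 a × v ~ a × ¬ a ~ x × v ~ b × a ~ b

  attached? : Decidable Attached
  attached? v x = D3? v ×-dec ¬? (D3? x) ×-dec (v ~? x) ×-dec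
    any? λ a → any? λ b → D3? a ×-dec (v ~? a) ×-dec ¬? (a ~? x) ×-dec (v ~? b) ×-dec (a ~? b)

  -- By saturation both attachments use the same `a`. Among the neighbours `a`, `b`, `x` of `v`,
  -- only `x` can be `y`: `a` has degree 3, and `b` is adjacent to `a`.
  attached-unique : ∀ {v x y} → Attached v x → Attached v y → x ≡ y
  attached-unique {v} {x} {y} (dv , ¬dx , v~x , a , b , da , v~a , a≁x , v~b , a~b)
    (_ , ¬dy , v~y , a′ , b′ , da′ , v~a′ , a′≁y , _)
    with refl ← D3-neighbour-unique dv v~a v~a′ da da′
    with star-covers (star v~a v~b v~x (~⇒≢ a~b) (D3-≢ da ¬dx) λ { refl → a≁x a~b }) v~y
  ... | inj₁ refl = contradiction da ¬dy
  ... | inj₂ (inj₁ refl) = contradiction a~b a′≁y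
  ... | inj₂ (inj₂ y≡x) = ≡-sym y≡x

  Linked : V → V → Set
  Linked v v′ = ∃₂ λ x x′ → Attached v x × Attached v′ x′ × x ~ x′

  -- `v` determines `x`. As `x` has degree at most 2, its neighbours are `v` and `x′`, so `x′` is
  -- determined; likewise `x′` determines `v′`.
  linked-matching : IsMatching Linked
  linked-matching .IsMatching.dec v v′ =
    any? λ x → any? λ x′ → attached? v x ×-dec attached? v′ x′ ×-dec (x ~? x′)
  linked-matching .IsMatching.symmetric (x , x′ , att , att′ , x~x′) = x′ , x , att′ , att , ~-sym x~x′
  linked-matching .IsMatching.irreflexive (x , x′ , att , att′ , x~x′) =
    ~⇒≢ x~x′ (attached-unique att att′)
  linked-matching .IsMatching.functional
    (x , x′ , att@(dv , ¬dx , v~x , _) , (dv′ , ¬dx′ , v′~x′ , _) , x~x′)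
    (y , y′ , att₂ , (dv″ , ¬dy′ , v″~y′ , _) , y~y′)
    with refl ← attached-unique att att₂
    with pair-covers ¬dx (~-sym v~x) x~x′ (D3-≢ dv ¬dx′) y~y′
  ... | inj₁ refl = contradiction dv ¬dy′
  ... | inj₂ refl with pair-covers ¬dx′ (~-sym x~x′) (~-sym v′~x′) (≢-sym (D3-≢ dv′ ¬dx)) (~-sym v″~y′)
  ...   | inj₁ refl = contradiction dv″ ¬dx
  ...   | inj₂ v″≡v′ = ≡-sym v″≡v′

  Bonded : V → V → Set
  Bonded u v = D3 u × D3 v × u ~ v

  bonded-matching : IsMatching Bonded
  bonded-matching .IsMatching.dec u v = D3? u ×-dec D3? v ×-dec (u ~? v)
  bonded-matching .IsMatching.symmetric (du , dv , u~v) = dv , du , ~-sym u~v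
  bonded-matching .IsMatching.irreflexive (_ , _ , u~u) = ~-irrefl u~u
  bonded-matching .IsMatching.functional (du , dv , u~v) (_ , dw , u~w) =
    D3-neighbour-unique du u~v u~w dv dw

  -- Twins.

  Twin : V → Set
  Twin a = ¬ D3 a × ∃ λ c → c ≢ a × ¬ D3 c ×
    ∃₂ λ v b → v ≢ b × D3 v × a ~ v × a ~ b × c ~ v × c ~ b

  twin? : Unary.Decidable Twin
  twin? a = ¬? (D3? a) ×-dec any? λ c → ¬? (c ≟ a) ×-dec ¬? (D3? c) ×-dec
    any? λ v → any? λ b → ¬? (v ≟ b) ×-dec D3? v ×-dec
      (a ~? v) ×-dec (a ~? b) ×-dec (c ~? v) ×-dec (c ~? b)

  -- `v` and `b` are all the neighbours of `a`, and `c` is adjacent to both.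
  twin-partner : ∀ {a y} → Twin a → a ~ y → ∃ λ c → c ≢ a × c ~ y × Twin c
  twin-partner (¬da , c , c≢a , ¬dc , v , b , v≢b , dv , a~v , a~b , c~v , c~b) a~y =
    c , c≢a , c~y (pair-covers ¬da a~v a~b v≢b a~y) ,
    (¬dc , _ , ≢-sym c≢a , ¬da , v , b , v≢b , dv , c~v , c~b , a~v , a~b)
    where
    c~y : ∀ {y} → y ≡ v ⊎ y ≡ b → c ~ y
    c~y (inj₁ refl) = c~v
    c~y (inj₂ refl) = c~b

  -- The twin and its partner are both neighbours of `x`, hence its only ones, and neither has
  -- degree 3.
  twin-neighbour : ∀ {a x v} → Twin a → a ~ x → ¬ D3 x → x ~ v → ¬ D3 v
  twin-neighbour tw@(¬da , _) a~x ¬dx x~v dv with twin-partner tw a~x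
  ... | c , c≢a , c~x , (¬dc , _) with pair-covers ¬dx (~-sym a~x) (~-sym c~x) (≢-sym c≢a) x~v
  ...   | inj₁ refl = ¬da dv
  ...   | inj₂ refl = ¬dc dv

  -- Greedy extension of independent sets.

  Independent : (V → Set) → Set
  Independent J = ∀ {u w} → J u → J w → ¬ u ~ w

  -- A vertex of the list is added when it has no neighbour in the set built so far; otherwise that
  -- neighbour dominates it for good, because the set only grows.
  extendIndependent : {J : V → Set} → Unary.Decidable J → Independent J → (xs : List V) →
    ∃ λ (I : V → Set) → Unary.Decidable I × Independent I × (∀ {u} → J u → I u) ×
      (∀ {u} → I u → J u ⊎ u ∈ xs) × (∀ {u} → u ∈ xs → ¬ I u → ∃ λ w → u ~ w × I w)
  extendIndependent {J} J? indep [] = J , J? , indep , (λ Ju → Ju) , inj₁ , λ ()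
  extendIndependent J? indep (x ∷ xs) with extendIndependent J? indep xs
  ... | I , I? , indepI , J⊆I , I⊆ , dominated with any? (λ w → (x ~? w) ×-dec I? w)
  ...   | yes x-dominated = I , I? , indepI , J⊆I , map₂ there ∘ I⊆ ,
    λ { (here refl) _ → x-dominated ; (there u∈) → dominated u∈ }
  ...   | no x-free = (λ u → u ≡ x ⊎ I u) , (λ u → (u ≟ x) ⊎-dec I? u) , indep′ , inj₂ ∘ J⊆I ,
    (λ { (inj₁ u≡x) → inj₂ (here u≡x) ; (inj₂ Iu) → map₂ there (I⊆ Iu) }) ,
    λ { (here u≡x) ¬I′ → contradiction (inj₁ u≡x) ¬I′
      ; (there u∈) ¬I′ → let w , u~w , Iw = dominated u∈ (¬I′ ∘ inj₂) in w , u~w , inj₂ Iw }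
    where
    indep′ : Independent (λ u → u ≡ x ⊎ I u)
    indep′ (inj₁ refl) (inj₁ refl) = ~-irrefl
    indep′ (inj₁ refl) (inj₂ Iw) x~w = x-free (_ , x~w , Iw)
    indep′ (inj₂ Iu) (inj₁ refl) u~x = x-free (_ , ~-sym u~x , Iu)
    indep′ (inj₂ Iu) (inj₂ Iw) = indepI Iu Iw

  -- Choosing the set for the colour of distance 1.

  module Selection (f : V → Bool) (f-bonded : Separates f Bonded) (f-linked : Separates f Linked) where

    Selected : V → Set
    Selected x = ∃ λ v → Attached v x × f v ≡ true

    Core : V → Set
    Core x = Twin x ⊎ Selected x

    core? : Unary.Decidable Core
    core? x = twin? x ⊎-dec any? (λ v → attached? v x ×-dec (f v ≟ᵇ true))

    -- Every core vertex has degree at most 2 and a degree-3 neighbour, so `twin-neighbour` excludes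
    -- it next to a twin. Adjacent selected vertices would link two vertices that both have
    -- `f`-colour `true`.
    core-independent : Independent Core
    core-independent (inj₁ tw) (inj₁ (¬dw , _ , _ , _ , _ , _ , _ , dv , w~v , _)) u~w =
      twin-neighbour tw u~w ¬dw w~v dv
    core-independent (inj₁ tw) (inj₂ (_ , (dv , ¬dw , v~w , _) , _)) u~w =
      twin-neighbour tw u~w ¬dw (~-sym v~w) dv
    core-independent (inj₂ (_ , (dv , ¬du , v~u , _) , _)) (inj₁ tw) u~w =
      twin-neighbour tw (~-sym u~w) ¬du (~-sym v~u) dv
    core-independent (inj₂ (_ , att , fv)) (inj₂ (_ , att′ , fv′)) u~w =
      f-linked (_ , _ , att , att′ , u~w) (trans fv (≡-sym fv′))

    record IsKernel (I : V → Set) : Set where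
      field
        I?          : Unary.Decidable I
        core⊆       : ∀ {u} → Core u → I u
        independent : Independent I
        maximal     : ∀ {u} → ¬ I u → ∃ λ w → u ~ w × I w
        prefers-D3  : ∀ {u} → D3 u → ¬ I u → ∃ λ w → u ~ w × I w × (Core w ⊎ D3 w)

    -- Two greedy stages: the core is extended first by degree-3 vertices only, which gives
    -- `prefers-D3`, and then by arbitrary vertices, which gives maximality.
    kernel : ∃ IsKernel
    kernel = I₂ , record
      { I?          = I₂?
      ; core⊆       = I₁⊆I₂ ∘ core⊆I₁
      ; independent = indep₂
      ; maximal     = dom₂ (∈-allFin _)
      ; prefers-D3  = λ du ¬I₂u →
          let w , u~w , I₁w = dom₁ (∈-filter⁺ D3? (∈-allFin _) du) (¬I₂u ∘ I₁⊆I₂)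
          in w , u~w , I₁⊆I₂ I₁w , map₂ is-D3 (I₁⊆ I₁w)
      }
      where
      is-D3 : ∀ {w} → w ∈ filter D3? (allFin _) → D3 w
      is-D3 w∈ = proj₂ (∈-filter⁻ D3? {xs = allFin _} w∈)
      stage₁ = extendIndependent core? core-independent (filter D3? (allFin _))
      I₁? = proj₁ (proj₂ stage₁)
      indep₁ = proj₁ (proj₂ (proj₂ stage₁))
      core⊆I₁ = proj₁ (proj₂ (proj₂ (proj₂ stage₁)))
      I₁⊆ = proj₁ (proj₂ (proj₂ (proj₂ (proj₂ stage₁))))
      dom₁ = proj₂ (proj₂ (proj₂ (proj₂ (proj₂ stage₁))))
      stage₂ = extendIndependent I₁? indep₁ (allFin _)
      I₂ = proj₁ stage₂
      I₂? = proj₁ (proj₂ stage₂)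
      indep₂ = proj₁ (proj₂ (proj₂ stage₂))
      I₁⊆I₂ = proj₁ (proj₂ (proj₂ (proj₂ stage₂)))
      dom₂ = proj₂ (proj₂ (proj₂ (proj₂ (proj₂ stage₂))))

    -- The vertices coloured last.
    Last : V → Set
    Last u = ¬ D3 u × ∃₂ λ v t → D3 v × v ~ u × v ~ t × t ≢ u × Closed v u t

    last? : Unary.Decidable Last
    last? u = ¬? (D3? u) ×-dec any? λ v → any? λ t →
      D3? v ×-dec (v ~? u) ×-dec (v ~? t) ×-dec ¬? (t ≟ u) ×-dec closed? v u t

    -- Heavy vertices within distance two of a heavy vertex.

    module Degeneracy {I : V → Set} (isKernel : IsKernel I) where
      open IsKernel isKernel

      -- The vertices outside the kernel that are coloured in the first round.
      Heavy : V → Set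
      Heavy u = ¬ I u × ¬ Last u

      heavy? : Unary.Decidable Heavy
      heavy? u = ¬? (I? u) ×-dec ¬? (last? u)

      -- Otherwise `a` would be coloured last. With saturation, at most one of the two cycle
      -- neighbours of `v` is heavy.
      heavy⇒D3 : ∀ {v a b c} → Star v a b c → D3 v → Closed v a b → Heavy a → D3 a
      heavy⇒D3 {a = a} (star ~a ~b _ a≢b _ _) dv closed (_ , ¬last) =
        decidable-stable (D3? a) λ ¬da → ¬last (¬da , _ , _ , dv , ~a , ~b , ≢-sym a≢b , closed)

      -- By `prefers-D3`, `y` has a kernel neighbour that is in the core or of degree 3. It is not
      -- `a`; if it is `b`, then `b` has degree at most 2 and lies in the core, and each way of
      -- lying there leads to `c` or to a contradiction.
      third-in-kernel : ∀ {y a b c} → Star y a b c → D3 y → D3 a → Closed y a b →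
        ¬ I y → ¬ I a → I c
      third-in-kernel {y} {a} {b} {c} st@(star ~a ~b ~c a≢b a≢c b≢c) dy da closed ¬Iy ¬Ia
        with w , y~w , Iw , kind ← prefers-D3 dy ¬Iy with star-covers st y~w
      ... | inj₁ refl = contradiction Iw ¬Ia
      ... | inj₂ (inj₂ refl) = Iw
      ... | inj₂ (inj₁ refl) with kind
      ...   | inj₂ db = contradiction (D3-neighbour-unique dy ~a ~b da db) a≢b
      ...   | inj₁ (inj₁ twin) = partner-is-c (twin-partner twin (~-sym ~b))
        where
        partner-is-c : (∃ λ p → p ≢ b × p ~ y × Twin p) → I c
        partner-is-c (p , p≢b , p~y , twin-p) with star-covers st (~-sym p~y)
        ... | inj₁ refl = contradiction da (proj₁ twin-p)
        ... | inj₂ (inj₁ p≡b) = contradiction p≡b p≢b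
        ... | inj₂ (inj₂ refl) = core⊆ (inj₁ twin-p)
      ...   | inj₁ (inj₂ (v , (dv , ¬db , v~b , a′ , b′ , da′ , v~a′ , a′≁b , v~b′ , a′~b′) , _)) = from closed
        where
        from-y : y ≡ v → ∃ λ t → ¬ a ~ b × y ~ t × a ~ t
        from-y refl with refl ← D3-neighbour-unique dy ~a v~a′ da da′ = b′ , a′≁b , v~b′ , a′~b′
        from : Closed y a b → I c
        -- `b` is attached to `y` or to `a`, and the other of these is its degree-3 partner, which
        -- may not be adjacent to `b`.
        from (inj₁ a~b) with pair-covers ¬db (~-sym ~b) (~-sym a~b) (~⇒≢ ~a) (~-sym v~b)
        ... | inj₁ refl = contradiction a~b (proj₁ (proj₂ (from-y refl)))
        ... | inj₂ refl with refl ← D3-neighbour-unique da (~-sym ~a) v~a′ dy da′ = contradiction ~b a′≁b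
        -- If `b` is attached to `s`, then `a` has two degree-3 neighbours. If it is attached to
        -- `y`, the triangle there must be `y a c`.
        from (inj₂ (s , s≢y , a~s , b~s)) with pair-covers ¬db (~-sym ~b) b~s (≢-sym s≢y) (~-sym v~b)
        ... | inj₂ refl = contradiction (D3-neighbour-unique da (~-sym ~a) a~s dy dv) (≢-sym s≢y)
        ... | inj₁ refl with t , a≁b , ~t , a~t ← from-y refl with star-covers st ~t
        ...   | inj₁ refl = contradiction a~t ~-irrefl
        ...   | inj₂ (inj₁ refl) = contradiction a~t a≁b
        ...   | inj₂ (inj₂ refl) = via-a (maximal ¬Ia)
          where
          ¬dc : ¬ D3 c
          ¬dc dc = a≢c (D3-neighbour-unique dy ~a ~c da dc)
          s≢c : s ≢ c
          s≢c refl with pair-covers ¬dc (~-sym ~c) (~-sym a~t) (~⇒≢ ~a) (~-sym b~s)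
          ... | inj₁ refl = ~-irrefl ~b
          ... | inj₂ refl = a≢b refl
          -- The kernel neighbour of `a` is not `y`, nor `s`, which is adjacent to the kernel vertex
          -- `b`.
          via-a : (∃ λ z → a ~ z × I z) → I c
          via-a (z , a~z , Iz)
            with star-covers (star (~-sym ~a) a~s a~t (≢-sym s≢y) (~⇒≢ ~c) s≢c) a~z
          ... | inj₁ refl = contradiction Iz ¬Iy
          ... | inj₂ (inj₁ refl) = contradiction b~s (independent Iw Iz)
          ... | inj₂ (inj₂ refl) = Iz

      Via : V → V → Set
      Via y w = w ≡ y ⊎ y ~ w

      -- `b` is light. If `y` is outside the kernel, then a heavy `a` would force `u` into the
      -- kernel by `third-in-kernel`.
      via-D3-from-outside : ∀ {y a b u} → Star y a b u → D3 y → D3 a → Closed y a b → ¬ I u →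
        AtMostOne λ w → w ≢ u × Heavy w × Via y w
      via-D3-from-outside {y} {a} {b} {u} st@(star ~a ~b _ a≢b _ _) dy da closed ¬Iu with I? y
      ... | yes Iy = a , only
        where
        only : ∀ {w} → w ≢ u × Heavy w × Via y w → w ≡ a
        only (_ , (¬Iw , _) , inj₁ refl) = contradiction Iy ¬Iw
        only (w≢u , hw , inj₂ y~w) with star-covers st y~w
        ... | inj₁ w≡a = w≡a
        ... | inj₂ (inj₁ refl) = contradiction
          (D3-neighbour-unique dy ~a ~b da (heavy⇒D3 (swap-star st) dy (swap-closed closed) hw)) a≢b
        ... | inj₂ (inj₂ w≡u) = contradiction w≡u w≢u
      ... | no ¬Iy = y , only
        where
        only : ∀ {w} → w ≢ u × Heavy w × Via y w → w ≡ y
        only (_ , _ , inj₁ w≡y) = w≡y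
        only (w≢u , hw , inj₂ y~w) with star-covers st y~w
        ... | inj₁ refl = contradiction (third-in-kernel st dy da closed ¬Iy (proj₁ hw)) ¬Iu
        ... | inj₂ (inj₁ refl) = contradiction
          (D3-neighbour-unique dy ~a ~b da (heavy⇒D3 (swap-star st) dy (swap-closed closed) hw)) a≢b
        ... | inj₂ (inj₂ w≡u) = contradiction w≡u w≢u

      -- A heavy `u` on the cycle has degree 3, so `b` is light. If `y` is outside the kernel, then
      -- `c` is inside it by `third-in-kernel`.
      via-D3-from-cycle : ∀ {y u b c} → Star y u b c → D3 y → Closed y u b → Heavy u →
        AtMostOne λ w → w ≢ u × Heavy w × Via y w
      via-D3-from-cycle {y} {u} {b} {c} st@(star ~u ~b _ u≢b _ _) dy closed hu = bound (I? y)
        where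
        du = heavy⇒D3 st dy closed hu
        b-light : ¬ Heavy b
        b-light hb = u≢b
          (D3-neighbour-unique dy ~u ~b du (heavy⇒D3 (swap-star st) dy (swap-closed closed) hb))
        bound : Dec (I y) → AtMostOne λ w → w ≢ u × Heavy w × Via y w
        bound (yes Iy) = c , only
          where
          only : ∀ {w} → w ≢ u × Heavy w × Via y w → w ≡ c
          only (_ , (¬Iw , _) , inj₁ refl) = contradiction Iy ¬Iw
          only (w≢u , hw , inj₂ y~w) with star-covers st y~w
          ... | inj₁ w≡u = contradiction w≡u w≢u
          ... | inj₂ (inj₁ refl) = contradiction hw b-light
          ... | inj₂ (inj₂ w≡c) = w≡c
        bound (no ¬Iy) = y , only
          where
          only : ∀ {w} → w ≢ u × Heavy w × Via y w → w ≡ y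
          only (_ , _ , inj₁ w≡y) = w≡y
          only (w≢u , hw , inj₂ y~w) with star-covers st y~w
          ... | inj₁ w≡u = contradiction w≡u w≢u
          ... | inj₂ (inj₁ refl) = contradiction hw b-light
          ... | inj₂ (inj₂ refl) =
            contradiction (third-in-kernel st dy du closed ¬Iy (proj₁ hu)) (proj₁ hw)

      -- For `y` of degree 3, `u` lies on its short cycle or is its third neighbour. For other `y`
      -- at most one further neighbour exists, and it is in the kernel whenever `y` is not.
      via-bound : ∀ {u} → Heavy u → ∀ y → u ~ y → AtMostOne λ w → w ≢ u × Heavy w × Via y w
      via-bound {u} hu y u~y with D3? y
      ... | yes dy with a , b , c , st , closed ← short-cycle dy with star-covers st (~-sym u~y)
      ...   | inj₁ refl = via-D3-from-cycle st dy closed hu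
      ...   | inj₂ (inj₁ refl) = via-D3-from-cycle (swap-star st) dy (swap-closed closed) hu
      ...   | inj₂ (inj₂ refl) with D3? a | D3? b
      ...     | yes da | _ = via-D3-from-outside st dy da closed (proj₁ hu)
      ...     | no _ | yes db =
        via-D3-from-outside (swap-star st) dy db (swap-closed closed) (proj₁ hu)
      ...     | no ¬da | no ¬db = y , only
        where
        only : ∀ {w} → w ≢ u × Heavy w × Via y w → w ≡ y
        only (_ , _ , inj₁ w≡y) = w≡y
        only (w≢u , hw , inj₂ y~w) with star-covers st y~w
        ... | inj₁ refl = contradiction (heavy⇒D3 st dy closed hw) ¬da
        ... | inj₂ (inj₁ refl) = contradiction (heavy⇒D3 (swap-star st) dy (swap-closed closed) hw) ¬db
        ... | inj₂ (inj₂ w≡u) = contradiction w≡u w≢u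
      via-bound {u} hu y u~y | no ¬dy with I? y
      ... | no ¬Iy = y , only
        where
        only : ∀ {w} → w ≢ u × Heavy w × Via y w → w ≡ y
        only (_ , _ , inj₁ w≡y) = w≡y
        only (w≢u , (¬Iw , _) , inj₂ y~w) with r , y~r , Ir ← maximal ¬Iy
          with pair-covers ¬dy (~-sym u~y) y~r (λ { refl → proj₁ hu Ir }) y~w
        ... | inj₁ w≡u = contradiction w≡u w≢u
        ... | inj₂ refl = contradiction Ir ¬Iw
      ... | yes Iy with any? (λ r → (y ~? r) ×-dec ¬? (r ≟ u))
      ...   | yes (r , y~r , r≢u) = r , only
        where
        only : ∀ {w} → w ≢ u × Heavy w × Via y w → w ≡ r
        only (_ , (¬Iw , _) , inj₁ refl) = contradiction Iy ¬Iw
        only (w≢u , _ , inj₂ y~w) with pair-covers ¬dy (~-sym u~y) y~r (≢-sym r≢u) y~w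
        ... | inj₁ w≡u = contradiction w≡u w≢u
        ... | inj₂ w≡r = w≡r
      -- No vertex qualifies here; `u` is a dummy candidate.
      ...   | no leaf = u , only
        where
        only : ∀ {w} → w ≢ u × Heavy w × Via y w → w ≡ u
        only (_ , (¬Iw , _) , inj₁ refl) = contradiction Iy ¬Iw
        only (w≢u , _ , inj₂ y~w) = contradiction (_ , y~w , w≢u) leaf

      ViaPair : V → V → V → V → Set
      ViaPair u a b w = w ≢ u × Heavy w × (Via a w ⊎ Via b w)

      swap-pair : ∀ {u a b} → AtMostOne (ViaPair u b a) → AtMostOne (ViaPair u a b)
      swap-pair (p , only) = p , λ (w≢u , hw , via) → only (w≢u , hw , swap via)

      -- `s` follows `a` on the cycle and `y` is the third neighbour of `a`. Taking `s` to be `b` in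
      -- a triangle treats both cycle lengths at once. Only `a` and `y` can be heavy, and if `a` is
      -- outside the kernel, `third-in-kernel` puts `y` inside.
      via-bonded-pair : ∀ {u a s y b} → D3 u → ¬ I u → D3 a → Star a u s y → Closed a u s →
        ¬ Heavy b → (∀ {w} → b ~ w → w ≡ u ⊎ w ≡ s ⊎ w ≡ a) → AtMostOne (ViaPair u a b)
      via-bonded-pair {u} {a} {s} {y} {b} du ¬Iu da st@(star ~u ~s ~y u≢s _ _) closed b-light b-nbrs =
        bound (I? a)
        where
        s-light : ¬ Heavy s
        s-light hs = u≢s
          (D3-neighbour-unique da ~u ~s du (heavy⇒D3 (swap-star st) da (swap-closed closed) hs))
        a-or-y : ∀ {w} → ViaPair u a b w → w ≡ a ⊎ w ≡ y
        a-or-y (_ , _ , inj₁ (inj₁ w≡a)) = inj₁ w≡a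
        a-or-y (w≢u , hw , inj₁ (inj₂ a~w)) with star-covers st a~w
        ... | inj₁ w≡u = contradiction w≡u w≢u
        ... | inj₂ (inj₁ refl) = contradiction hw s-light
        ... | inj₂ (inj₂ w≡y) = inj₂ w≡y
        a-or-y (_ , hw , inj₂ (inj₁ refl)) = contradiction hw b-light
        a-or-y (w≢u , hw , inj₂ (inj₂ b~w)) with b-nbrs b~w
        ... | inj₁ w≡u = contradiction w≡u w≢u
        ... | inj₂ (inj₁ refl) = contradiction hw s-light
        ... | inj₂ (inj₂ w≡a) = inj₁ w≡a
        bound : Dec (I a) → AtMostOne (ViaPair u a b)
        bound (yes Ia) = y , only
          where
          only : ∀ {w} → ViaPair u a b w → w ≡ y
          only q with a-or-y q
          ... | inj₁ refl = contradiction Ia (proj₁ (proj₁ (proj₂ q)))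
          ... | inj₂ w≡y = w≡y
        bound (no ¬Ia) = a , only
          where
          only : ∀ {w} → ViaPair u a b w → w ≡ a
          only q with a-or-y q
          ... | inj₁ w≡a = w≡a
          ... | inj₂ refl =
            contradiction (third-in-kernel st da du closed ¬Ia ¬Iu) (proj₁ (proj₁ (proj₂ q)))

      via-pair-bonded : ∀ {u a b c} → Star u a b c → D3 u → ¬ I u → Closed u a b → D3 a →
        AtMostOne (ViaPair u a b)
      via-pair-bonded {u} {a} {b} st@(star ~a ~b _ a≢b _ _) du ¬Iu closed da = from closed
        where
        b-light : ¬ Heavy b
        b-light hb =
          a≢b (D3-neighbour-unique du ~a ~b da (heavy⇒D3 (swap-star st) du (swap-closed closed) hb))
        ¬db : ¬ D3 b
        ¬db db = a≢b (D3-neighbour-unique du ~a ~b da db)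
        from : Closed u a b → AtMostOne (ViaPair u a b)
        from (inj₁ a~b) = via-bonded-pair du ¬Iu da
          (proj₂ (complete-star da (~-sym ~a) a~b (~⇒≢ ~b))) (inj₁ ~b) b-light b-nbrs
          where
          b-nbrs : ∀ {w} → b ~ w → w ≡ u ⊎ w ≡ b ⊎ w ≡ a
          b-nbrs b~w = map₂ inj₂ (pair-covers ¬db (~-sym ~b) (~-sym a~b) (~⇒≢ ~a) b~w)
        from (inj₂ (s , s≢u , a~s , b~s)) = via-bonded-pair du ¬Iu da
          (proj₂ (complete-star da (~-sym ~a) a~s (≢-sym s≢u)))
          (inj₂ (b , ≢-sym a≢b , ~b , ~-sym b~s)) b-light b-nbrs
          where
          b-nbrs : ∀ {w} → b ~ w → w ≡ u ⊎ w ≡ s ⊎ w ≡ a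
          b-nbrs b~w = map₂ inj₁ (pair-covers ¬db (~-sym ~b) b~s (≢-sym s≢u) b~w)

      -- For a degree-3 vertex a bound per neighbour would allow three heavy vertices; its two cycle
      -- neighbours together account for only one. If neither has degree 3, only the opposite vertex
      -- of a 4-cycle is left.
      via-pair-bound : ∀ {u a b c} → Star u a b c → D3 u → ¬ I u → Closed u a b →
        AtMostOne (ViaPair u a b)
      via-pair-bound {u} {a} {b} st@(star ~a ~b _ a≢b _ _) du ¬Iu closed with D3? a | D3? b
      ... | yes da | _ = via-pair-bonded st du ¬Iu closed da
      ... | no _ | yes db = swap-pair (via-pair-bonded (swap-star st) du ¬Iu (swap-closed closed) db)
      ... | no ¬da | no ¬db = from closed
        where
        a-light : ¬ Heavy a
        a-light ha = ¬da (heavy⇒D3 st du closed ha)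
        b-light : ¬ Heavy b
        b-light hb = ¬db (heavy⇒D3 (swap-star st) du (swap-closed closed) hb)
        from : Closed u a b → AtMostOne (ViaPair u a b)
        -- In a triangle nothing is left, and `u` is a dummy candidate.
        from (inj₁ a~b) = u , only
          where
          only : ∀ {w} → ViaPair u a b w → w ≡ u
          only (_ , hw , inj₁ (inj₁ refl)) = contradiction hw a-light
          only (_ , hw , inj₂ (inj₁ refl)) = contradiction hw b-light
          only (_ , hw , inj₁ (inj₂ a~w)) with pair-covers ¬da (~-sym ~a) a~b (~⇒≢ ~b) a~w
          ... | inj₁ w≡u = w≡u
          ... | inj₂ refl = contradiction hw b-light
          only (_ , hw , inj₂ (inj₂ b~w)) with pair-covers ¬db (~-sym ~b) (~-sym a~b) (~⇒≢ ~a) b~w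
          ... | inj₁ w≡u = w≡u
          ... | inj₂ refl = contradiction hw a-light
        from (inj₂ (s , s≢u , a~s , b~s)) = s , only
          where
          only : ∀ {w} → ViaPair u a b w → w ≡ s
          only (_ , hw , inj₁ (inj₁ refl)) = contradiction hw a-light
          only (_ , hw , inj₂ (inj₁ refl)) = contradiction hw b-light
          only (w≢u , _ , inj₁ (inj₂ a~w)) with pair-covers ¬da (~-sym ~a) a~s (≢-sym s≢u) a~w
          ... | inj₁ w≡u = contradiction w≡u w≢u
          ... | inj₂ w≡s = w≡s
          only (w≢u , _ , inj₂ (inj₂ b~w)) with pair-covers ¬db (~-sym ~b) b~s (≢-sym s≢u) b~w
          ... | inj₁ w≡u = contradiction w≡u w≢u
          ... | inj₂ w≡s = w≡s

      -- Between distinct vertices this is adjacency in the square of `G`.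
      Reach : V → V → Set
      Reach u w = ∃ λ y → u ~ y × Via y w

      reach-sym : ∀ {u w} → Reach u w → Reach w u
      reach-sym (y , u~y , inj₁ refl) = _ , ~-sym u~y , inj₁ refl
      reach-sym (y , u~y , inj₂ y~w) = y , ~-sym y~w , inj₂ (~-sym u~y)

      -- Needed because the candidates from `¬D3⇒few-neighbours` may fail to be neighbours.
      via-bound? : ∀ {u} → Heavy u → ∀ y → AtMostOne λ w → w ≢ u × Heavy w × u ~ y × Via y w
      via-bound? {u} hu y with u ~? y
      ... | yes u~y = let p , only = via-bound hu y u~y
                      in p , λ (w≢u , hw , _ , via) → only (w≢u , hw , via)
      ... | no u≁y = u , λ (_ , _ , u~y , _) → contradiction u~y u≁y

      -- At a degree-3 vertex the cycle pair accounts for one vertex and the third neighbour for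
      -- another; otherwise each of at most two neighbours accounts for one.
      heavy-few : ∀ {u} → Heavy u → AtMostTwo λ w → w ≢ u × Reach u w × Heavy w
      heavy-few {u} hu with D3? u
      ... | yes du with a , b , c , st , closed ← short-cycle du
        with p , onlyp ← via-pair-bound st du (proj₁ hu) closed
        with q , onlyq ← via-bound hu c (Star.~c st) = p , q , only
        where
        only : ∀ {w} → w ≢ u × Reach u w × Heavy w → w ≡ p ⊎ w ≡ q
        only (w≢u , (y , u~y , via) , hw) with star-covers st u~y
        ... | inj₁ refl = inj₁ (onlyp (w≢u , hw , inj₁ via))
        ... | inj₂ (inj₁ refl) = inj₁ (onlyp (w≢u , hw , inj₂ via))
        ... | inj₂ (inj₂ refl) = inj₂ (onlyq (w≢u , hw , via))
      heavy-few {u} hu | no ¬du with a , b , cover ← ¬D3⇒few-neighbours ¬du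
        with p , onlyp ← via-bound? hu a with q , onlyq ← via-bound? hu b = p , q , only
        where
        only : ∀ {w} → w ≢ u × Reach u w × Heavy w → w ≡ p ⊎ w ≡ q
        only (w≢u , (y , u~y , via) , hw) with cover u~y
        ... | inj₁ refl = inj₁ (onlyp (w≢u , hw , u~y , via))
        ... | inj₂ refl = inj₂ (onlyq (w≢u , hw , u~y , via))

      -- Vertices coloured last.

      -- If `t` is not adjacent to `w`, then `w` is attached to `v` through the triangle `v t u`,
      -- hence selected. Otherwise `w` is the third neighbour of `t`.
      attachment-in-kernel : ∀ {u v t w z} → ¬ D3 u → D3 v → D3 t →
        Star v u t w → Star t u v z → f v ≡ true → w ≡ z ⊎ I w
      attachment-in-kernel {u} {v} {t} {w} {z} ¬du dv dt (star v~u v~t v~w u≢t u≢w t≢w) st fv with t ~? w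
      ... | no t≁w = inj₂ (core⊆ (inj₂ (v ,
              (dv , (λ dw → t≢w (D3-neighbour-unique dv v~t v~w dt dw)) , v~w ,
                t , u , dt , v~t , t≁w , v~u , Star.~a st) , fv)))
      ... | yes t~w with star-covers st t~w
      ...   | inj₁ w≡u = contradiction w≡u (≢-sym u≢w)
      ...   | inj₂ (inj₁ refl) = contradiction v~w ~-irrefl
      ...   | inj₂ (inj₂ w≡z) = inj₁ w≡z

      Near : V → V → Set
      Near u w = w ≢ u × Reach u w × ¬ I w

      -- By maximality `v` or `t` is in the kernel, which leaves one of them. If `t` has degree 3,
      -- the outer neighbours `w` and `z` coincide or one of them is in the kernel; otherwise `w` is
      -- the only outer neighbour.
      last-few-triangle : ∀ {u v t w} → ¬ D3 u → ¬ I u → D3 v → Star v u t w → u ~ t →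
        AtMostTwo (Near u)
      last-few-triangle {u} {v} {t} {w} ¬du ¬Iu dv st@(star v~u v~t v~w u≢t u≢w t≢w) u~t = bound (D3? t)
        where
        u-nbrs : ∀ {x} → u ~ x → x ≡ v ⊎ x ≡ t
        u-nbrs = pair-covers ¬du (~-sym v~u) u~t (~⇒≢ v~t)
        one-in : I v ⊎ I t
        one-in with r , u~r , Ir ← maximal ¬Iu with u-nbrs u~r
        ... | inj₁ refl = inj₁ Ir
        ... | inj₂ refl = inj₂ Ir
        others : ∃ λ p → ∀ {x} → ¬ I x → x ≡ v ⊎ x ≡ t → x ≡ p
        others = pick one-in
          where
          pick : I v ⊎ I t → ∃ λ p → ∀ {x} → ¬ I x → x ≡ v ⊎ x ≡ t → x ≡ p
          pick (inj₁ Iv) = t , λ { ¬Ix (inj₁ refl) → contradiction Iv ¬Ix ; _ (inj₂ x≡t) → x≡t }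
          pick (inj₂ It) = v , λ { _ (inj₁ x≡v) → x≡v ; ¬Ix (inj₂ refl) → contradiction It ¬Ix }
        p = proj₁ others
        bound : Dec (D3 t) → AtMostTwo (Near u)
        bound (no ¬dt) = p , w , only
          where
          only : ∀ {x} → Near u x → x ≡ p ⊎ x ≡ w
          only (x≢u , (y , u~y , via) , ¬Ix) with u-nbrs u~y | via
          ... | y≡ | inj₁ refl = inj₁ (proj₂ others ¬Ix y≡)
          ... | inj₁ refl | inj₂ v~x with star-covers st v~x
          ...   | inj₁ x≡u = contradiction x≡u x≢u
          ...   | inj₂ (inj₁ x≡t) = inj₁ (proj₂ others ¬Ix (inj₂ x≡t))
          ...   | inj₂ (inj₂ x≡w) = inj₂ x≡w
          only (x≢u , (y , u~y , via) , ¬Ix) | inj₂ refl | inj₂ t~x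
            with pair-covers ¬dt (~-sym u~t) (~-sym v~t) (~⇒≢ (~-sym v~u)) t~x
          ... | inj₁ x≡u = contradiction x≡u x≢u
          ... | inj₂ x≡v = inj₁ (proj₂ others ¬Ix (inj₁ x≡v))
        bound (yes dt) with z , st′ ← complete-star dt (~-sym u~t) (~-sym v~t) (~⇒≢ (~-sym v~u)) =
          p , proj₁ outer , only
          where
          outer : ∃ λ q → ∀ {x} → ¬ I x → x ≡ w ⊎ x ≡ z → x ≡ q
          outer with f v ≟ᵇ true
          ... | yes fv = choose (attachment-in-kernel ¬du dv dt st st′ fv)
            where
            choose : w ≡ z ⊎ I w → ∃ λ q → ∀ {x} → ¬ I x → x ≡ w ⊎ x ≡ z → x ≡ q
            choose (inj₁ refl) = w , λ { _ (inj₁ x≡w) → x≡w ; _ (inj₂ x≡w) → x≡w }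
            choose (inj₂ Iw) = z , λ { ¬Ix (inj₁ refl) → contradiction Iw ¬Ix ; _ (inj₂ x≡z) → x≡z }
          ... | no ¬fv = choose (attachment-in-kernel ¬du dt dv st′ st ft)
            where
            -- `v` and `t` are bonded, so exactly one of them has colour `true`.
            ft : f t ≡ true
            ft = trans (¬-not (≢-sym (f-bonded (dv , dt , v~t)))) (cong not (¬-not ¬fv))
            choose : z ≡ w ⊎ I z → ∃ λ q → ∀ {x} → ¬ I x → x ≡ w ⊎ x ≡ z → x ≡ q
            choose (inj₁ refl) = w , λ { _ (inj₁ x≡w) → x≡w ; _ (inj₂ x≡w) → x≡w }
            choose (inj₂ Iz) = w , λ { _ (inj₁ x≡w) → x≡w ; ¬Ix (inj₂ refl) → contradiction Iz ¬Ix }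
          only : ∀ {x} → Near u x → x ≡ p ⊎ x ≡ proj₁ outer
          only (x≢u , (y , u~y , via) , ¬Ix) with u-nbrs u~y | via
          ... | y≡ | inj₁ refl = inj₁ (proj₂ others ¬Ix y≡)
          ... | inj₁ refl | inj₂ v~x with star-covers st v~x
          ...   | inj₁ x≡u = contradiction x≡u x≢u
          ...   | inj₂ (inj₁ x≡t) = inj₁ (proj₂ others ¬Ix (inj₂ x≡t))
          ...   | inj₂ (inj₂ x≡w) = inj₂ (proj₂ outer ¬Ix (inj₁ x≡w))
          only (x≢u , (y , u~y , via) , ¬Ix) | inj₂ refl | inj₂ t~x with star-covers st′ t~x
          ... | inj₁ x≡u = contradiction x≡u x≢u
          ... | inj₂ (inj₁ x≡v) = inj₁ (proj₂ others ¬Ix (inj₁ x≡v))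
          ... | inj₂ (inj₂ x≡z) = inj₂ (proj₂ outer ¬Ix (inj₂ x≡z))

      -- `u` is outside the kernel, so it is no twin and `t` has degree 3, whence `s` does not. The
      -- candidates are `v`, `s`, `t`, `w`; the kernel contains `v` and `s`, or `s` and `w`.
      last-few-square : ∀ {u v t w s} → ¬ D3 u → ¬ I u → D3 v → Star v u t w →
        s ≢ v → u ~ s → t ~ s → AtMostTwo (Near u)
      last-few-square {u} {v} {t} {w} {s} ¬du ¬Iu dv st@(star v~u v~t v~w u≢t u≢w t≢w) s≢v u~s t~s =
        bound (I? v)
        where
        dt : D3 t
        dt = decidable-stable (D3? t) λ ¬dt → ¬Iu (core⊆ (inj₁
          (¬du , t , ≢-sym u≢t , ¬dt , v , s , ≢-sym s≢v , dv , ~-sym v~u , u~s , ~-sym v~t , t~s)))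
        ¬ds : ¬ D3 s
        ¬ds ds = s≢v (≡-sym (D3-neighbour-unique dt (~-sym v~t) t~s dv ds))
        u-nbrs : ∀ {x} → u ~ x → x ≡ v ⊎ x ≡ s
        u-nbrs = pair-covers ¬du (~-sym v~u) u~s (≢-sym s≢v)
        s-nbrs : ∀ {x} → s ~ x → x ≡ u ⊎ x ≡ t
        s-nbrs = pair-covers ¬ds (~-sym u~s) (~-sym t~s) u≢t
        near : ∀ {x} → Near u x → x ≡ v ⊎ x ≡ s ⊎ x ≡ t ⊎ x ≡ w
        near (x≢u , (y , u~y , via) , ¬Ix) with u-nbrs u~y | via
        ... | inj₁ y≡v | inj₁ refl = inj₁ y≡v
        ... | inj₂ y≡s | inj₁ refl = inj₂ (inj₁ y≡s)
        ... | inj₁ refl | inj₂ v~x = [ (λ x≡u → contradiction x≡u x≢u) , inj₂ ∘ inj₂ ] (star-covers st v~x)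
        ... | inj₂ refl | inj₂ s~x =
          [ (λ x≡u → contradiction x≡u x≢u) , inj₂ ∘ inj₂ ∘ inj₁ ] (s-nbrs s~x)
        bound : Dec (I v) → AtMostTwo (Near u)
        bound (yes Iv) = t , w , only
          where
          Is : I s
          Is = decidable-stable (I? s) λ ¬Is → blocked (maximal ¬Is)
            where
            blocked : ¬ ∃ λ x → s ~ x × I x
            blocked (x , s~x , Ix) with s-nbrs s~x
            ... | inj₁ refl = ¬Iu Ix
            ... | inj₂ refl = independent Iv Ix v~t
          only : ∀ {x} → Near u x → x ≡ t ⊎ x ≡ w
          only nx@(_ , _ , ¬Ix) with near nx
          ... | inj₁ refl = contradiction Iv ¬Ix
          ... | inj₂ (inj₁ refl) = contradiction Is ¬Ix
          ... | inj₂ (inj₂ x≡) = x≡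
        bound (no ¬Iv) = v , t , only
          where
          Is : I s
          Is with r , u~r , Ir ← maximal ¬Iu with u-nbrs u~r
          ... | inj₁ refl = contradiction Ir ¬Iv
          ... | inj₂ refl = Ir
          Iw : I w
          Iw with r , v~r , Ir ← maximal ¬Iv with star-covers st v~r
          ... | inj₁ refl = contradiction Ir ¬Iu
          ... | inj₂ (inj₁ refl) = contradiction t~s (independent Ir Is)
          ... | inj₂ (inj₂ refl) = Ir
          only : ∀ {x} → Near u x → x ≡ v ⊎ x ≡ t
          only nx@(_ , _ , ¬Ix) with near nx
          ... | inj₁ x≡v = inj₁ x≡v
          ... | inj₂ (inj₁ refl) = contradiction Is ¬Ix
          ... | inj₂ (inj₂ (inj₁ x≡t)) = inj₂ x≡t
          ... | inj₂ (inj₂ (inj₂ refl)) = contradiction Iw ¬Ix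

      last-few : ∀ {u} → Last u → ¬ I u → AtMostTwo (Near u)
      last-few (¬du , v , t , dv , v~u , v~t , t≢u , closed) ¬Iu
        with w , st ← complete-star dv v~u v~t (≢-sym t≢u) with closed
      ... | inj₁ u~t = last-few-triangle ¬du ¬Iu dv st u~t
      ... | inj₂ (s , s≢v , u~s , t~s) = last-few-square ¬du ¬Iu dv st s≢v u~s t~s

      -- Assembling the packing colouring.

      outside-colouring : ∃ (ProperOn reach-sym (λ u → ¬ I u))
      outside-colouring = proj₁ stage₂ , λ ¬Iu ¬Iv → proj₂ stage₂ (split ¬Iu) (split ¬Iv)
        where
        light? : Unary.Decidable λ u → ¬ I u × Last u
        light? u = ¬? (I? u) ×-dec last? u
        heavies = filter heavy? (allFin _)
        lights = filter light? (allFin _)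
        heavy∈ : ∀ {u} → u ∈ heavies → Heavy u
        heavy∈ u∈ = proj₂ (∈-filter⁻ heavy? {xs = allFin _} u∈)
        light∈ : ∀ {u} → u ∈ lights → ¬ I u × Last u
        light∈ u∈ = proj₂ (∈-filter⁻ light? {xs = allFin _} u∈)
        outside : ∀ {u} → (⊥ ⊎ u ∈ heavies) ⊎ u ∈ lights → ¬ I u
        outside (inj₁ (inj₂ u∈)) = proj₁ (heavy∈ u∈)
        outside (inj₂ u∈) = proj₁ (light∈ u∈)
        split : ∀ {u} → ¬ I u → (⊥ ⊎ u ∈ heavies) ⊎ u ∈ lights
        split {u} ¬Iu with last? u
        ... | yes lu = inj₂ (∈-filter⁺ light? (∈-allFin u) (¬Iu , lu))
        ... | no ¬lu = inj₁ (inj₂ (∈-filter⁺ heavy? (∈-allFin u) (¬Iu , ¬lu)))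
        -- Nothing is coloured before the heavy vertices, so the initial colouring is arbitrary.
        stage₁ = extendColouring reach-sym {P = λ _ → ⊥} {c = λ _ → zero} (λ ()) heavies λ x∈ →
          let p , q , only = heavy-few (heavy∈ x∈)
          in p , q , λ { (w≢x , r , inj₂ w∈) → only (w≢x , r , heavy∈ w∈) }
        stage₂ = extendColouring reach-sym (proj₂ stage₁) lights λ x∈ →
          let p , q , only = last-few (proj₂ (light∈ x∈)) (proj₁ (light∈ x∈))
          in p , q , λ (w≢x , r , w∈) → only (w≢x , r , outside w∈)

      colourable : PackingColorable G 4 S1222
      colourable = colour , packing
        where
        c = proj₁ outside-colouring
        proper = proj₂ outside-colouring
        colour : V → Fin 4
        colour u with I? u
        ... | yes _ = zero
        ... | no _  = suc (c u)
        walk⇒reach : ∀ {u v k} → u ≢ v → k ≤ 2 → Walk G u v k → Reach u v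
        walk⇒reach u≢v _ here = contradiction refl u≢v
        walk⇒reach _ _ (step u~v here) = _ , u~v , inj₁ refl
        walk⇒reach _ _ (step u~y (step y~v here)) = _ , u~y , inj₂ y~v
        walk⇒reach _ (s≤s (s≤s ())) (step _ (step _ (step _ _)))
        packing : PackingColoring G 4 S1222 colour
        packing u v u≢v same k k≤ walk with I? u | I? v
        packing u v u≢v _ k k≤ here | yes _ | yes _ = contradiction refl u≢v
        packing u v u≢v same k k≤ (step u~v here) | yes Iu | yes Iv = independent Iu Iv u~v
        -- The kernel colour has distance bound 1, so longer walks are excluded.
        packing u v u≢v same k (s≤s ()) (step _ (step _ _)) | yes Iu | yes Iv
        packing u v u≢v same k k≤ walk | no ¬Iu | no ¬Iv =
          proper ¬Iu ¬Iv u≢v (walk⇒reach u≢v k≤ walk) (suc-injective same)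

theorem2 : (G : Graph) → Subcubic G → Saturated 1 G → G3AtMost G 4 →
    PackingColorable G 4 S1222
theorem2 G subcubic saturated g₃≤4 =
  let open LocalStructure G subcubic saturated g₃≤4
      f , f-bonded , f-linked = two-matchings-2-colourable bonded-matching linked-matching
      open Selection f f-bonded f-linked
      _ , isKernel = kernel
      open Degeneracy isKernel
  in colourable
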